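{- Let $K_{(1,n)}$ be the star with one central vertex and $n$ leaves. Over all index patterns $\mathscr{I}$ of $K_{(1,n)}$: (i) $$\min_{\mathscr{I}} mw(\mathbb{K}_{(1,n),\mathscr{I}})=\begin{cases}2\sum\limits_{i=1}^{\lceil\frac{n+1}{2}\rceil-1} i+\left\lceil\frac{n+1}{2}\right\rceil, & \text{if } n\ge 3 \text{ is odd},\\[2mm] 2\sum\limits_{i=1}^{\lceil\frac{n+1}{2}\rceil-1} i, & \text{if } n\ge 2\text{ is even}.\end{cases}$$ (ii) $$\max_{\mathscr{I}} mw(\mathbb{K}_{(1,n),\mathscr{I}})=\sum_{i=1}^{n} i\quad\text{for all } n\in\mathbb{N},\ n\ge 1.$$
   Context: An index pattern $\mathscr{I}$ of a graph on $N$ vertices is a bijective labelling of its vertices by $v_1,\dots,v_N$ (so the vertices carry the indices $1,\dots,N$; here $N=n+1$). The sprout graph of a graph $G$ with respect to $\mathscr{I}$ is the directed graph on $V(G)$ obtained by replacing every edge $v_iv_j$ of $G$ with $i<j$ by the arc $(v_i,v_j)$; $\mathbb{K}_{(1,n),\mathscr{I}}$ is the sprout graph of $K_{(1,n)}$. The weight of the arc $(v_i,v_j)$ is $j-i$, and the maturity weight $mw$ of a sprout graph is the sum of the weights of all its arcs. -}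

module Defs where

open import Algebra.Properties.Monoid.Sum using (sum-syntax)
open import Data.Bool.Base using (if_then_else_)
open import Data.Fin.Base using (Fin; zero; suc; toℕ)
open import Data.Fin.Permutation using (Permutation′; _⟨$⟩ʳ_)
open import Data.Nat.Base using (ℕ; zero; suc; _∸_; _≤_; _<_)
open import Data.Nat.Properties using (+-0-monoid; _<?_)
open import Data.Product.Base using (_×_; _,_; ∃-syntax)
open import Level using (0ℓ)
open import Relation.Binary.Core using (Rel)
open import Relation.Binary.Definitions using (Decidable; Irreflexive; Symmetric)
open import Relation.Binary.PropositionalEquality.Core using (_≡_; refl)
open import Relation.Nullary.Decidable using (yes; no; does; _×-dec_)

∑ : ∀ n → (Fin n → ℕ) → ℕ
∑ n f = sum-syntax +-0-monoid n f

-- f 1 + f 2 + ⋯ + f k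
∑₁ : ∀ k → (ℕ → ℕ) → ℕ
∑₁ k f = ∑ k (λ i → f (suc (toℕ i)))

record Graph (N : ℕ) : Set₁ where
  field
    Adj    : Rel (Fin N) 0ℓ
    adj?   : Decidable Adj
    sym    : Symmetric Adj
    irrefl : Irreflexive _≡_ Adj

record Digraph (N : ℕ) : Set₁ where
  field
    Arc  : Rel (Fin N) 0ℓ
    arc? : Decidable Arc

-- A bijection from the vertices to their indices.  The elements of Fin N on
-- the vertex side are only names; they play no role in the weights.
IndexPattern : ℕ → Set
IndexPattern = Permutation′

-- Indices run through 1, …, N, whereas toℕ runs through 0, …, N - 1.
index : ∀ {N} → IndexPattern N → Fin N → ℕ
index 𝓘 v = suc (toℕ (𝓘 ⟨$⟩ʳ v))

sprout : ∀ {N} → Graph N → IndexPattern N → Digraph N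
sprout G 𝓘 = record
  { Arc  = λ u v → Adj u v × index 𝓘 u < index 𝓘 v
  ; arc? = λ u v → adj? u v ×-dec (index 𝓘 u <? index 𝓘 v)
  }
  where open Graph G

-- Only used on arcs of a sprout graph with respect to 𝓘, where
-- index 𝓘 u < index 𝓘 v, so the subtraction is never truncated.
weight : ∀ {N} → IndexPattern N → Fin N → Fin N → ℕ
weight 𝓘 u v = index 𝓘 v ∸ index 𝓘 u

mw : ∀ {N} → IndexPattern N → Digraph N → ℕ
mw {N} 𝓘 D =
  ∑ N λ u → ∑ N λ v → if does (arc? u v) then weight 𝓘 u v else 0
  where open Digraph D

data StarAdj {n : ℕ} : Rel (Fin (suc n)) 0ℓ where
  centre-leaf : ∀ i → StarAdj zero (suc i)
  leaf-centre : ∀ i → StarAdj (suc i) zero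

starAdj? : ∀ {n} → Decidable (StarAdj {n})
starAdj? zero    zero    = no λ ()
starAdj? zero    (suc i) = yes (centre-leaf i)
starAdj? (suc i) zero    = yes (leaf-centre i)
starAdj? (suc _) (suc _) = no λ ()

starSym : ∀ {n} → Symmetric (StarAdj {n})
starSym (centre-leaf i) = leaf-centre i
starSym (leaf-centre i) = centre-leaf i

starIrrefl : ∀ {n} → Irreflexive _≡_ (StarAdj {n})
starIrrefl {x = zero}  refl ()
starIrrefl {x = suc _} refl ()

star : ∀ n → Graph (suc n)
star n = record
  { Adj    = StarAdj
  ; adj?   = starAdj?
  ; sym    = starSym
  ; irrefl = starIrrefl
  }

-- m is the least (greatest) value of f, and it is attained.
IsMinimum : {A : Set} → (A → ℕ) → ℕ → Set
IsMinimum f m = (∃[ x ] f x ≡ m) × (∀ x → m ≤ f x)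

IsMaximum : {A : Set} → (A → ℕ) → ℕ → Set
IsMaximum f m = (∃[ x ] f x ≡ m) × (∀ x → f x ≤ m)

{-# OPTIONS --safe #-}

-- If the centre has index c + 1, the arcs of the sprout graph have as weights
-- the distances from c to the other elements of {0, …, n}, so the maturity
-- weight is T c + T (n ∸ c), where T k = 1 + ⋯ + k.  The maximum is at c = 0
-- because T is superadditive, and the minimum is at c = ⌊ n /2⌋ because
-- T (a + 1) + T (b + 1) exceeds T a + T b by an amount that depends only on
-- a + b, which reduces the comparison to the case where a or b is 0.
module Submission where

open import Defs
open import Algebra.Properties.CommutativeSemigroup using (interchange)
open import Data.Bool.Base using (if_then_else_)
open import Data.Fin.Base using (Fin; zero; suc; toℕ; fromℕ<; fromℕ; inject₁)
open import Data.Fin.Permutation using (_⟨$⟩ʳ_; transpose)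
open import Data.Fin.Properties using (toℕ-fromℕ; toℕ-fromℕ<; toℕ-inject₁; toℕ≤pred[n])
open import Data.Nat.Base
  using (ℕ; zero; suc; _+_; _*_; _∸_; _≤_; _<_; z≤n; s≤s; ∣_-_∣; ⌊_/2⌋; ⌈_/2⌉)
open import Data.Nat.Divisibility using (_∣_; _∤_; _∣0; ∣-refl; ∣1⇒≡1; ∣m+n∣m⇒∣n; ∣m∣n⇒∣m+n)
open import Data.Nat.Properties
open import Algebra.Properties.CommutativeMonoid.Sum +-0-commutativeMonoid
  using (sum-cong-≗; sum-replicate-zero; sum-init-last; ∑-distrib-+; sum-permute)
open import Data.Product.Base using (_×_; _,_; ∃-syntax)
open import Function.Base using (_∘_)
open import Relation.Binary.PropositionalEquality
  using (_≡_; refl; sym; trans; cong; cong₂; subst; module ≡-Reasoning)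
open import Relation.Nullary.Decidable using (Dec; yes; no; does)
open import Relation.Nullary.Negation using (contradiction)

triangular : ℕ → ℕ
triangular k = ∑₁ k (λ i → i)

-- `∑` unfolds at its first term, so splitting off the largest summand does not hold by computation
-- and goes through `sum-init-last`.
triangular-suc : ∀ k → triangular (suc k) ≡ suc k + triangular k
triangular-suc k = begin
  triangular (suc k)
    ≡⟨ sum-init-last {k} (suc ∘ toℕ) ⟩
  ∑ k (suc ∘ toℕ ∘ inject₁) + suc (toℕ (fromℕ k))
    ≡⟨ cong₂ _+_ (sum-cong-≗ {k} (cong suc ∘ toℕ-inject₁)) (cong suc (toℕ-fromℕ k)) ⟩
  triangular k + suc k
    ≡⟨ +-comm (triangular k) (suc k) ⟩
  suc k + triangular k ∎
  where open ≡-Reasoning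

-- Raising `a` by one adds `suc a` on the left and the larger `suc (a + b)` on the right.
triangular-superadditive : ∀ a b → triangular a + triangular b ≤ triangular (a + b)
triangular-superadditive zero    b = ≤-refl
triangular-superadditive (suc a) b = begin
  triangular (suc a) + triangular b
    ≡⟨ cong (_+ triangular b) (triangular-suc a) ⟩
  suc a + triangular a + triangular b
    ≡⟨ +-assoc (suc a) (triangular a) (triangular b) ⟩
  suc a + (triangular a + triangular b)
    ≤⟨ +-mono-≤ (m≤m+n (suc a) b) (triangular-superadditive a b) ⟩
  suc (a + b) + triangular (a + b)
    ≡⟨ triangular-suc (a + b) ⟨
  triangular (suc a + b) ∎
  where open ≤-Reasoning

triangular-suc-+ : ∀ a b → triangular (suc a) + triangular (suc b)
                         ≡ suc (suc (a + b)) + (triangular a + triangular b)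
triangular-suc-+ a b = begin
  triangular (suc a) + triangular (suc b)
    ≡⟨ cong₂ _+_ (triangular-suc a) (triangular-suc b) ⟩
  (suc a + triangular a) + (suc b + triangular b)
    ≡⟨ interchange +-commutativeSemigroup (suc a) (triangular a) (suc b) (triangular b) ⟩
  (suc a + suc b) + (triangular a + triangular b)
    ≡⟨ cong (λ k → suc k + (triangular a + triangular b)) (+-suc a b) ⟩
  suc (suc (a + b)) + (triangular a + triangular b) ∎
  where open ≡-Reasoning

triangular-halves-≤ : ∀ n → triangular ⌊ n /2⌋ + triangular ⌈ n /2⌉ ≤ triangular n
triangular-halves-≤ n =
  subst (λ k → triangular ⌊ n /2⌋ + triangular ⌈ n /2⌉ ≤ triangular k) (⌊n/2⌋+⌈n/2⌉≡n n)
    (triangular-superadditive ⌊ n /2⌋ ⌈ n /2⌉)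

-- Induction lowers `a` and `b` together: both halves of `a + b` then drop by one, and the two sides
-- lose the same amount. Once `a` or `b` is 0, superadditivity applied to the two halves suffices.
triangular-halves-minimal : ∀ a b →
  triangular ⌊ a + b /2⌋ + triangular ⌈ a + b /2⌉ ≤ triangular a + triangular b
triangular-halves-minimal zero    b    = triangular-halves-≤ b
triangular-halves-minimal (suc a) zero
  rewrite +-identityʳ a | +-identityʳ (triangular (suc a)) = triangular-halves-≤ (suc a)
triangular-halves-minimal (suc a) (suc b) rewrite +-suc a b = begin
  triangular (suc ⌊ a + b /2⌋) + triangular (suc ⌈ a + b /2⌉)
    ≡⟨ triangular-suc-+ ⌊ a + b /2⌋ ⌈ a + b /2⌉ ⟩
  suc (suc (⌊ a + b /2⌋ + ⌈ a + b /2⌉)) + (triangular ⌊ a + b /2⌋ + triangular ⌈ a + b /2⌉)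
    ≡⟨ cong (λ k → suc (suc k) + (triangular ⌊ a + b /2⌋ + triangular ⌈ a + b /2⌉))
         (⌊n/2⌋+⌈n/2⌉≡n (a + b)) ⟩
  suc (suc (a + b)) + (triangular ⌊ a + b /2⌋ + triangular ⌈ a + b /2⌉)
    ≤⟨ +-monoʳ-≤ (suc (suc (a + b))) (triangular-halves-minimal a b) ⟩
  suc (suc (a + b)) + (triangular a + triangular b)
    ≡⟨ triangular-suc-+ a b ⟨
  triangular (suc a) + triangular (suc b) ∎
  where open ≤-Reasoning

-- The term at `j = 0` is `c` itself; without it, the sum is the same one for `c` and `n` both
-- lowered by one. At `c = 0` the distances are 0, ..., `n`.
∑-distance : ∀ {c n} → c ≤ n →
  ∑ (suc n) (λ j → ∣ c - toℕ j ∣) ≡ triangular c + triangular (n ∸ c)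
∑-distance {zero}          _         = refl
∑-distance {suc c} {suc n} (s≤s c≤n) = begin
  suc c + ∑ (suc n) (λ j → ∣ c - toℕ j ∣)
    ≡⟨ cong (suc c +_) (∑-distance c≤n) ⟩
  suc c + (triangular c + triangular (n ∸ c))
    ≡⟨ +-assoc (suc c) (triangular c) (triangular (n ∸ c)) ⟨
  suc c + triangular c + triangular (n ∸ c)
    ≡⟨ cong (_+ triangular (n ∸ c)) (triangular-suc c) ⟨
  triangular (suc c) + triangular (n ∸ c) ∎
  where open ≡-Reasoning

[n∸m]+[m∸n]≡∣m-n∣ : ∀ m n → (n ∸ m) + (m ∸ n) ≡ ∣ m - n ∣
[n∸m]+[m∸n]≡∣m-n∣ zero    n       = trans (cong (n +_) (0∸n≡0 n)) (+-identityʳ n)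
[n∸m]+[m∸n]≡∣m-n∣ (suc m) zero    = refl
[n∸m]+[m∸n]≡∣m-n∣ (suc m) (suc n) = [n∸m]+[m∸n]≡∣m-n∣ m n

-- When the test fails, truncated subtraction already gives the default 0.
if-<-then-∸ : ∀ {m n} (m<?n : Dec (m < n)) → (if does m<?n then n ∸ m else 0) ≡ n ∸ m
if-<-then-∸ (yes _)  = refl
if-<-then-∸ (no m≮n) = sym (m≤n⇒m∸n≡0 (≮⇒≥ m≮n))

starWeight : ∀ n → IndexPattern (1 + n) → ℕ
starWeight n 𝓘 = mw 𝓘 (sprout (star n) 𝓘)

starWeight-centre : ∀ n 𝓘 →
  let c = toℕ (𝓘 ⟨$⟩ʳ zero) in starWeight n 𝓘 ≡ triangular c + triangular (n ∸ c)
starWeight-centre n 𝓘 = begin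
  starWeight n 𝓘
    -- The row of the centre holds the arcs to leaves of larger index. In the row of a leaf only the
    -- entry at the centre can be nonzero.
    ≡⟨ cong₂ _+_
         (sum-cong-≗ {n} (λ i → if-<-then-∸ (index 𝓘 zero <? index 𝓘 (suc i))))
         (sum-cong-≗ {n} (λ i → trans
           (cong₂ _+_ (if-<-then-∸ (index 𝓘 (suc i) <? index 𝓘 zero)) (sum-replicate-zero n))
           (+-identityʳ (c ∸ x (suc i))))) ⟩
  ∑ n (λ i → x (suc i) ∸ c) + ∑ n (λ i → c ∸ x (suc i))
    ≡⟨ ∑-distrib-+ (λ i → x (suc i) ∸ c) (λ i → c ∸ x (suc i)) ⟨
  ∑ n (λ i → (x (suc i) ∸ c) + (c ∸ x (suc i)))
    ≡⟨ sum-cong-≗ {n} (λ i → [n∸m]+[m∸n]≡∣m-n∣ c (x (suc i))) ⟩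
  ∑ n (λ i → ∣ c - x (suc i) ∣)
    -- Adding the centre's distance 0 to itself makes the sum run over all vertices, so that it can
    -- be reindexed along `𝓘`.
    ≡⟨ cong (_+ ∑ n (λ i → ∣ c - x (suc i) ∣)) (∣n-n∣≡0 c) ⟨
  ∑ (suc n) (λ v → ∣ c - x v ∣)
    ≡⟨ sum-permute (λ j → ∣ c - toℕ j ∣) 𝓘 ⟨
  ∑ (suc n) (λ j → ∣ c - toℕ j ∣)
    ≡⟨ ∑-distance (toℕ≤pred[n] (𝓘 ⟨$⟩ʳ zero)) ⟩
  triangular c + triangular (n ∸ c) ∎
  where
  open ≡-Reasoning
  x : Fin (suc n) → ℕ
  x v = toℕ (𝓘 ⟨$⟩ʳ v)
  c : ℕ
  c = x zero

starWeight-attains : ∀ {n} c → c ≤ n →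
  ∃[ 𝓘 ] starWeight n 𝓘 ≡ triangular c + triangular (n ∸ c)
starWeight-attains {n} c c≤n = 𝓘 , trans (starWeight-centre n 𝓘)
  (cong (λ k → triangular k + triangular (n ∸ k)) (toℕ-fromℕ< (s≤s c≤n)))
  where
  𝓘 : IndexPattern (1 + n)
  -- Only the image of the centre affects the weight; this swap sends it to `c`.
  𝓘 = transpose zero (fromℕ< (s≤s c≤n))

starWeight-minimum : ∀ n →
  IsMinimum (starWeight n) (triangular ⌊ n /2⌋ + triangular ⌈ n /2⌉)
starWeight-minimum n =
  subst (λ k → ∃[ 𝓘 ] starWeight n 𝓘 ≡ triangular ⌊ n /2⌋ + triangular k)
    n∸⌊n/2⌋≡⌈n/2⌉ (starWeight-attains ⌊ n /2⌋ (⌊n/2⌋≤n n))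
  , lower-bound
  where
  n∸⌊n/2⌋≡⌈n/2⌉ : n ∸ ⌊ n /2⌋ ≡ ⌈ n /2⌉
  n∸⌊n/2⌋≡⌈n/2⌉ = trans (cong (_∸ ⌊ n /2⌋) (sym (⌊n/2⌋+⌈n/2⌉≡n n)))
    (m+n∸m≡n ⌊ n /2⌋ ⌈ n /2⌉)

  lower-bound : ∀ 𝓘 → triangular ⌊ n /2⌋ + triangular ⌈ n /2⌉ ≤ starWeight n 𝓘
  lower-bound 𝓘 = begin
    triangular ⌊ n /2⌋ + triangular ⌈ n /2⌉
      -- Splitting `n` as `c + (n ∸ c)` exhibits the halves of `n` as those of a sum.
      ≡⟨ cong (λ k → triangular ⌊ k /2⌋ + triangular ⌈ k /2⌉)
           (m+[n∸m]≡n (toℕ≤pred[n] (𝓘 ⟨$⟩ʳ zero))) ⟨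
    triangular ⌊ c + (n ∸ c) /2⌋ + triangular ⌈ c + (n ∸ c) /2⌉
      ≤⟨ triangular-halves-minimal c (n ∸ c) ⟩
    triangular c + triangular (n ∸ c)
      ≡⟨ starWeight-centre n 𝓘 ⟨
    starWeight n 𝓘 ∎
    where
    open ≤-Reasoning
    c : ℕ
    c = toℕ (𝓘 ⟨$⟩ʳ zero)

starWeight-maximum : ∀ n → IsMaximum (starWeight n) (triangular n)
starWeight-maximum n = starWeight-attains 0 z≤n , upper-bound
  where
  upper-bound : ∀ 𝓘 → starWeight n 𝓘 ≤ triangular n
  upper-bound 𝓘 = begin
    starWeight n 𝓘
      ≡⟨ starWeight-centre n 𝓘 ⟩
    triangular c + triangular (n ∸ c)
      ≤⟨ triangular-superadditive c (n ∸ c) ⟩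
    triangular (c + (n ∸ c))
      ≡⟨ cong triangular (m+[n∸m]≡n (toℕ≤pred[n] (𝓘 ⟨$⟩ʳ zero))) ⟩
    triangular n ∎
    where
    open ≤-Reasoning
    c : ℕ
    c = toℕ (𝓘 ⟨$⟩ʳ zero)

2∣n⇒⌈n/2⌉≡⌊n/2⌋ : ∀ {n} → 2 ∣ n → ⌈ n /2⌉ ≡ ⌊ n /2⌋
2∣n⇒⌈n/2⌉≡⌊n/2⌋ {zero}        _   = refl
2∣n⇒⌈n/2⌉≡⌊n/2⌋ {suc zero}    2∣1 with () ← ∣1⇒≡1 2∣1
2∣n⇒⌈n/2⌉≡⌊n/2⌋ {suc (suc n)} 2∣n = cong suc (2∣n⇒⌈n/2⌉≡⌊n/2⌋ (∣m+n∣m⇒∣n 2∣n ∣-refl))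

2∤n⇒⌈n/2⌉≡1+⌊n/2⌋ : ∀ {n} → 2 ∤ n → ⌈ n /2⌉ ≡ suc ⌊ n /2⌋
2∤n⇒⌈n/2⌉≡1+⌊n/2⌋ {zero}        2∤0 = contradiction (2 ∣0) 2∤0
2∤n⇒⌈n/2⌉≡1+⌊n/2⌋ {suc zero}    _   = refl
2∤n⇒⌈n/2⌉≡1+⌊n/2⌋ {suc (suc n)} 2∤n = cong suc (2∤n⇒⌈n/2⌉≡1+⌊n/2⌋ (2∤n ∘ ∣m∣n⇒∣m+n ∣-refl))

m+m≡2*m : ∀ m → m + m ≡ 2 * m
m+m≡2*m m = cong (m +_) (sym (+-identityʳ m))

⌈n+1/2⌉≡1+⌊n/2⌋ : ∀ n → ⌈ n + 1 /2⌉ ≡ suc ⌊ n /2⌋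
-- `⌈ 1 + n /2⌉` unfolds to `⌊ 2 + n /2⌋`, which computes to the right-hand side.
⌈n+1/2⌉≡1+⌊n/2⌋ n = cong ⌈_/2⌉ (+-comm n 1)

-- With `h = ⌊ n /2⌋` the halves are `h` and `suc h`, and `suc h` is both the extra summand and
-- `⌈ n + 1 /2⌉`.
triangular-halves-odd : ∀ {n} → 2 ∤ n →
  triangular ⌊ n /2⌋ + triangular ⌈ n /2⌉ ≡ 2 * triangular (⌈ n + 1 /2⌉ ∸ 1) + ⌈ n + 1 /2⌉
triangular-halves-odd {n} 2∤n
  rewrite ⌈n+1/2⌉≡1+⌊n/2⌋ n | 2∤n⇒⌈n/2⌉≡1+⌊n/2⌋ 2∤n = begin
  triangular h + triangular (suc h)
    ≡⟨ cong (triangular h +_) (trans (triangular-suc h) (+-comm (suc h) (triangular h))) ⟩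
  triangular h + (triangular h + suc h)
    ≡⟨ +-assoc (triangular h) (triangular h) (suc h) ⟨
  triangular h + triangular h + suc h
    ≡⟨ cong (_+ suc h) (m+m≡2*m (triangular h)) ⟩
  2 * triangular h + suc h ∎
  where
  open ≡-Reasoning
  h : ℕ
  h = ⌊ n /2⌋

triangular-halves-even : ∀ {n} → 2 ∣ n →
  triangular ⌊ n /2⌋ + triangular ⌈ n /2⌉ ≡ 2 * triangular (⌈ n + 1 /2⌉ ∸ 1)
triangular-halves-even {n} 2∣n
  rewrite ⌈n+1/2⌉≡1+⌊n/2⌋ n | 2∣n⇒⌈n/2⌉≡⌊n/2⌋ 2∣n = m+m≡2*m (triangular ⌊ n /2⌋)

theorem4p9 : ((∀ (n : ℕ) → 3 ≤ n → 2 ∤ n →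
    IsMinimum (λ (𝓘 : IndexPattern (1 + n)) → mw 𝓘 (sprout (star n) 𝓘))
    (2 * ∑₁ (⌈ n + 1 /2⌉ ∸ 1) (λ i → i) + ⌈ n + 1 /2⌉))
    × (∀ (n : ℕ) → 2 ≤ n → 2 ∣ n →
    IsMinimum (λ (𝓘 : IndexPattern (1 + n)) → mw 𝓘 (sprout (star n) 𝓘))
    (2 * ∑₁ (⌈ n + 1 /2⌉ ∸ 1) (λ i → i))))
    × (∀ (n : ℕ) → 1 ≤ n →
    IsMaximum (λ (𝓘 : IndexPattern (1 + n)) → mw 𝓘 (sprout (star n) 𝓘))
    (∑₁ n (λ i → i)))
theorem4p9 =
  ( (λ n _ 2∤n → subst (IsMinimum (starWeight n)) (triangular-halves-odd 2∤n) (starWeight-minimum n))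
  , (λ n _ 2∣n → subst (IsMinimum (starWeight n)) (triangular-halves-even 2∣n) (starWeight-minimum n)))
  , (λ n _ → starWeight-maximum n)
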